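{- Let $m\ge 1$ be an integer, let $G$ be a doubly regular tournament with $v=4m-1$ vertices, and let $\Gamma$ be a transitive subtournament of size $s$ in $G$. Let $\epsilon:=\sqrt{1+12m}-\lfloor\sqrt{1+12m}\rfloor$. Then the following hold. (1) $s\le -1+\lfloor\sqrt{1+12m}\rfloor$. (2) $s\le -2+\sqrt{1+12m}$ if $\epsilon=0$. (3) $s\le -2+\lfloor\sqrt{1+12m}\rfloor$ if $\epsilon\neq 0$ and $-1+\lfloor\sqrt{1+12m}\rfloor$ is odd. (4) $s\le -2+\lfloor\sqrt{1+12m}\rfloor$ if $\epsilon\neq 0$ and $\lfloor\sqrt{1+12m}\rfloor>(-1+\sqrt{1+48m})/2$.
   Context: A tournament is a finite digraph $G=(V,E)$ such that for any two distinct vertices $x,y$ exactly one of $(x,y)\in E$, $(y,x)\in E$ holds, and $(x,x)\notin E$ for all $x$. A vertex $x$ dominates $y$ if $(x,y)\in E$. A tournament with $v$ vertices is doubly regular if every vertex has in-degree and out-degree $(v-1)/2$ and the number of vertices dominated simultaneously by both vertices of a pair of two distinct vertices is a constant not depending on the choice of the pair (this constant is then $(v-3)/4$). A transitive tournament is a tournament such that $(x,y)\in E$ and $(y,z)\in E$ imply $(x,z)\in E$. A transitive subtournament of size $s$ in $G$ is an induced sub-digraph of $G$ on $s$ vertices which is a transitive tournament. -}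

module Defs where

open import Data.Empty using (⊥)
open import Data.Fin.Base using (Fin)
open import Data.Fin.Properties using () renaming (_≟_ to _≟ᶠ_)
open import Data.Fin.Subset using (Subset; _∈_; _∩_; ∣_∣)
open import Data.Integer.Base as ℤ using (ℤ; +_)
import Data.Integer.Properties as ℤ
open import Data.Nat.Base as ℕ using (ℕ; zero; suc)
import Data.Nat.Properties as ℕ
open import Data.Product.Base using (∃; _×_; _,_; proj₁)
open import Data.Rational.Base hiding (∣_∣)
open import Data.Rational.Properties
open import Data.Rational.Solver using (module +-*-Solver)
import Data.Rational.Unnormalised.Base as ℚᵘ
import Data.Rational.Unnormalised.Properties as ℚᵘ
open import Data.Sum.Base using (_⊎_; inj₁; inj₂)
open import Data.Vec.Base using (tabulate)
open import Function.Base using (_on_)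
open import Level using (0ℓ)
open import Relation.Binary.Core using (Rel)
open import Relation.Binary.Definitions using (Transitive; Decidable)
open import Relation.Binary.PropositionalEquality
  using (_≡_; _≢_; refl; sym; trans; cong; subst; subst₂)
open import Relation.Nullary using (¬_; yes; no; does)

------------------------------------------------------------------------
-- Tournaments

record IsTournament {V : Set} (E : Rel V 0ℓ) : Set where
  field
    exactlyOne : ∀ {x y} → x ≢ y → (E x y × ¬ E y x) ⊎ (¬ E x y × E y x)
    loopless   : ∀ {x} → ¬ E x x

record Tournament (v : ℕ) : Set₁ where
  field
    Dominates    : Rel (Fin v) 0ℓ
    isTournament : IsTournament Dominates

  open IsTournament isTournament public

  dominates? : Decidable Dominates
  dominates? x y with x ≟ᶠ y
  ... | yes refl = no loopless
  ... | no x≢y with exactlyOne x≢y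
  ...   | inj₁ (xy , _) = yes xy
  ...   | inj₂ (¬xy , _) = no ¬xy

  outNeighbours inNeighbours : Fin v → Subset v
  outNeighbours x = tabulate λ y → does (dominates? x y)
  inNeighbours  x = tabulate λ y → does (dominates? y x)

-- The degree (v - 1)/2 is not truncated: it is required that v = 1 + 2d.
record IsDoublyRegular {v : ℕ} (G : Tournament v) : Set where
  open Tournament G
  field
    inDegree  : ∀ x → 1 ℕ.+ 2 ℕ.* ∣ inNeighbours x ∣ ≡ v
    outDegree : ∀ x → 1 ℕ.+ 2 ℕ.* ∣ outNeighbours x ∣ ≡ v
    common    : ∃ λ k → ∀ {x y} → x ≢ y →
                ∣ outNeighbours x ∩ outNeighbours y ∣ ≡ k

record IsTransitiveTournament {V : Set} (E : Rel V 0ℓ) : Set where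
  field
    isTournament : IsTournament E
    transitive   : Transitive E

-- The sub-digraph induced on S has as vertices the pairs of a vertex of G
-- and a (unique) proof that it lies in S.
Induced : ∀ {v} (G : Tournament v) (S : Subset v) → Rel (∃ (_∈ S)) 0ℓ
Induced G S = Tournament.Dominates G on proj₁

record TransitiveSubtournament {v : ℕ} (G : Tournament v) (s : ℕ) : Set where
  field
    vertices     : Subset v
    size         : ∣ vertices ∣ ≡ s
    isTransitive : IsTransitiveTournament (Induced G vertices)

------------------------------------------------------------------------
-- Dedekind reals

record ℝ : Set₁ where
  field
    L U         : ℚ → Set
    L-inhabited : ∃ L
    U-inhabited : ∃ U
    L-lower     : ∀ {q r} → q < r → L r → L q
    U-upper     : ∀ {q r} → q < r → U q → U r
    L-open      : ∀ {q} → L q → ∃ λ r → q < r × L r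
    U-open      : ∀ {r} → U r → ∃ λ q → q < r × U q
    disjoint    : ∀ {q} → L q → U q → ⊥
    located     : ∀ {q r} → q < r → L q ⊎ U r

infix 4 _≤ᴿ_ _<ᴿ_ _≃ᴿ_

_≤ᴿ_ : ℝ → ℝ → Set
x ≤ᴿ y = ∀ {q} → ℝ.L x q → ℝ.L y q

_<ᴿ_ : ℝ → ℝ → Set
x <ᴿ y = ∃ λ q → ℝ.U x q × ℝ.L y q

_≃ᴿ_ : ℝ → ℝ → Set
x ≃ᴿ y = x ≤ᴿ y × y ≤ᴿ x

private
  open +-*-Solver

  -+ : ∀ r c → (r + c) - c ≡ r
  -+ = solve 2 (λ r c → (r :+ c) :- c := r) refl

  +- : ∀ r c → (r - c) + c ≡ r
  +- = solve 2 (λ r c → (r :- c) :+ c := r) refl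

  half : ∀ r → ½ * r + ½ * r ≡ r
  half r = trans (sym (*-distribʳ-+ r ½ ½)) (*-identityˡ r)

  half′ : ∀ r → ½ * (r + r) ≡ r
  half′ r = trans (*-distribˡ-+ ½ r r) (half r)

fromℚ : ℚ → ℝ
fromℚ c = record
  { L = _< c
  ; U = c <_
  ; L-inhabited = c - 1ℚ , subst (c - 1ℚ <_) (+-identityʳ c) (+-monoʳ-< c (negative⁻¹ (- 1ℚ)))
  ; U-inhabited = c + 1ℚ , subst (_< c + 1ℚ) (+-identityʳ c) (+-monoʳ-< c (positive⁻¹ 1ℚ))
  ; L-lower = <-trans
  ; U-upper = λ q<r c<q → <-trans c<q q<r
  ; L-open = <-dense
  ; U-open = λ c<r → let (q , c<q , q<r) = <-dense c<r in q , q<r , c<q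
  ; disjoint = <-asym
  ; located = loc
  }
  where
  loc : ∀ {q r} → q < r → q < c ⊎ c < r
  loc {q} q<r with q <? c
  ... | yes q<c = inj₁ q<c
  ... | no q≮c = inj₂ (≤-<-trans (≮⇒≥ q≮c) q<r)

fromℤ : ℤ → ℝ
fromℤ k = fromℚ (k / 1)

infixl 6 _⊕_
infixl 7 _÷2

-- Addition of an integer.
_⊕_ : ℝ → ℤ → ℝ
x ⊕ k = record
  { L = λ q → L (q - c)
  ; U = λ q → U (q - c)
  ; L-inhabited = let (r , l) = L-inhabited in r + c , subst L (sym (-+ r c)) l
  ; U-inhabited = let (r , u) = U-inhabited in r + c , subst U (sym (-+ r c)) u
  ; L-lower = λ q<r → L-lower (+-monoˡ-< (- c) q<r)
  ; U-upper = λ q<r → U-upper (+-monoˡ-< (- c) q<r)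
  ; L-open = λ {q} l → let (r , q<r , l′) = L-open l in
      r + c , subst (_< r + c) (+- q c) (+-monoˡ-< c q<r) , subst L (sym (-+ r c)) l′
  ; U-open = λ {q} u → let (r , r<q , u′) = U-open u in
      r + c , subst (r + c <_) (+- q c) (+-monoˡ-< c r<q) , subst U (sym (-+ r c)) u′
  ; disjoint = disjoint
  ; located = λ q<r → located (+-monoˡ-< (- c) q<r)
  }
  where
  open ℝ x
  c = k / 1

_÷2 : ℝ → ℝ
x ÷2 = record
  { L = λ q → L (q + q)
  ; U = λ q → U (q + q)
  ; L-inhabited = let (r , l) = L-inhabited in ½ * r , subst L (sym (half r)) l
  ; U-inhabited = let (r , u) = U-inhabited in ½ * r , subst U (sym (half r)) u
  ; L-lower = λ q<r → L-lower (+-mono-< q<r q<r)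
  ; U-upper = λ q<r → U-upper (+-mono-< q<r q<r)
  ; L-open = λ {q} l → let (r , q<r , l′) = L-open l in
      ½ * r , subst (_< ½ * r) (half′ q) (*-monoʳ-<-pos ½ q<r) , subst L (sym (half r)) l′
  ; U-open = λ {q} u → let (r , r<q , u′) = U-open u in
      ½ * r , subst (½ * r <_) (half′ q) (*-monoʳ-<-pos ½ r<q) , subst U (sym (half r)) u′
  ; disjoint = disjoint
  ; located = λ q<r → located (+-mono-< q<r q<r)
  }
  where open ℝ x

------------------------------------------------------------------------
-- Square roots

private
  0<- : ∀ {p q} → p < q → 0ℚ < q - p
  0<- {p} {q} p<q = subst (_< q - p) (+-inverseʳ p) (+-monoˡ-< (- p) p<q)

  -<0 : ∀ {p q} → 0ℚ < q - p → p < q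
  -<0 {p} {q} h = subst₂ _<_ (+-identityˡ p) (+- q p) (+-monoˡ-< p h)

  0<* : ∀ {p q} → 0ℚ < p → 0ℚ < q → 0ℚ < p * q
  0<* {p} {q} 0<p 0<q =
    positive⁻¹ (p * q) {{pos*pos⇒pos p {{positive 0<p}} q {{positive 0<q}}}}

  0≤* : ∀ {p q} → 0ℚ ≤ p → 0ℚ ≤ q → 0ℚ ≤ p * q
  0≤* {p} {q} 0≤p 0≤q =
    nonNegative⁻¹ (p * q) {{nonNeg*nonNeg⇒nonNeg p {{nonNegative 0≤p}} q {{nonNegative 0≤q}}}}

  square-mono-< : ∀ {q r} → 0ℚ ≤ q → q < r → q * q < r * r
  square-mono-< {q} {r} 0≤q q<r = -<0 (subst (0ℚ <_) (eq q r)
    (0<* (0<- q<r) (+-mono-<-≤ (≤-<-trans 0≤q q<r) 0≤q)))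
    where
    eq : ∀ q r → (r - q) * (r + q) ≡ r * r - q * q
    eq = solve 2 (λ q r → (r :- q) :* (r :+ q) := r :* r :- q :* q) refl

  -- For q ≥ 0 and c = N + 1, the rational (c q + N)/(q + c) lies strictly
  -- between q and the square root of N unless q² = N.
  module Improve {N : ℚ} (0≤N : 0ℚ ≤ N) {q : ℚ} (0≤q : 0ℚ ≤ q) where
    c w t d q′ : ℚ
    c = N + 1ℚ
    w = q + c
    t = c * q + N

    0<c : 0ℚ < c
    0<c = +-mono-≤-< 0≤N (positive⁻¹ 1ℚ)

    0<w : 0ℚ < w
    0<w = +-mono-≤-< 0≤q 0<c

    instance
      w-pos : Positive w
      w-pos = positive 0<w

      w-nonZero : NonZero w
      w-nonZero = pos⇒nonZero w

    d = 1/ w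
    q′ = t * d

    0<d : 0ℚ < d
    0<d = positive⁻¹ d {{1/pos⇒pos w}}

    0<c²-N : 0ℚ < c * c - N
    0<c²-N = subst (0ℚ <_) (eq N) (+-mono-≤-< (+-mono-≤ (0≤* 0≤N 0≤N) 0≤N) (positive⁻¹ 1ℚ))
      where
      eq : ∀ N → N * N + N + 1ℚ ≡ (N + 1ℚ) * (N + 1ℚ) - N
      eq = solve 1 (λ N → N :* N :+ N :+ con 1ℚ := (N :+ con 1ℚ) :* (N :+ con 1ℚ) :- N) refl

    wd : ∀ p → p * w * d ≡ p
    wd p = trans (*-assoc p w d) (trans (cong (p *_) (*-inverseʳ w)) (*-identityʳ p))

    wwdd : ∀ p → p * (w * w) * (d * d) ≡ p
    wwdd p = trans (eq p w d) (trans (wd (p * w * d)) (wd p))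
      where
      eq : ∀ p w d → p * (w * w) * (d * d) ≡ p * w * d * w * d
      eq = solve 3 (λ p w d → p :* (w :* w) :* (d :* d) := p :* w :* d :* w :* d) refl

    ttdd : t * t * (d * d) ≡ q′ * q′
    ttdd = eq t d
      where
      eq : ∀ t d → t * t * (d * d) ≡ t * d * (t * d)
      eq = solve 2 (λ t d → t :* t :* (d :* d) := t :* d :* (t :* d)) refl

    scale : ∀ a b e → 0ℚ < e → a < b → a * e < b * e
    scale _ _ e 0<e = *-monoˡ-<-pos e {{positive 0<e}}

    lower : q * q < N → q < q′ × q′ * q′ < N
    lower q²<N =
      subst (_< q′) (wd q) (scale (q * w) t d 0<d (-<0 (subst (0ℚ <_) (eq₁ q N c) (0<- q²<N)))) ,
      subst₂ _<_ ttdd (wwdd N) (scale (t * t) (N * (w * w)) (d * d) (0<* 0<d 0<d)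
        (-<0 (subst (0ℚ <_) (eq₂ q N c) (0<* 0<c²-N (0<- q²<N)))))
      where
      eq₁ : ∀ q N c → N - q * q ≡ (c * q + N) - q * (q + c)
      eq₁ = solve 3 (λ q N c → N :- q :* q := (c :* q :+ N) :- q :* (q :+ c)) refl
      eq₂ : ∀ q N c → (c * c - N) * (N - q * q) ≡
            N * ((q + c) * (q + c)) - (c * q + N) * (c * q + N)
      eq₂ = solve 3 (λ q N c → (c :* c :- N) :* (N :- q :* q) :=
            N :* ((q :+ c) :* (q :+ c)) :- (c :* q :+ N) :* (c :* q :+ N)) refl

    upper : N < q * q → q′ < q × N < q′ * q′
    upper N<q² =
      subst (q′ <_) (wd q) (scale t (q * w) d 0<d (-<0 (subst (0ℚ <_) (eq₁ q N c) (0<- N<q²)))) ,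
      subst₂ _<_ (wwdd N) ttdd (scale (N * (w * w)) (t * t) (d * d) (0<* 0<d 0<d)
        (-<0 (subst (0ℚ <_) (eq₂ q N c) (0<* 0<c²-N (0<- N<q²)))))
      where
      eq₁ : ∀ q N c → q * q - N ≡ q * (q + c) - (c * q + N)
      eq₁ = solve 3 (λ q N c → q :* q :- N := q :* (q :+ c) :- (c :* q :+ N)) refl
      eq₂ : ∀ q N c → (c * c - N) * (q * q - N) ≡
            (c * q + N) * (c * q + N) - N * ((q + c) * (q + c))
      eq₂ = solve 3 (λ q N c → (c :* c :- N) :* (q :* q :- N) :=
            (c :* q :+ N) :* (c :* q :+ N) :- N :* ((q :+ c) :* (q :+ c))) refl

    q′-pos : 0ℚ < q → 0ℚ < q′
    q′-pos 0<q = 0<* (+-mono-<-≤ (0<* 0<c 0<q) 0≤N) 0<d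

  0≤ℕ : ∀ n → 0ℚ ≤ + n / 1
  0≤ℕ n = nonNegative⁻¹ (+ n / 1) {{normalize-nonNeg n 1}}

√_ : ℕ → ℝ
√ n = record
  { L = L
  ; U = U
  ; L-inhabited = - 1ℚ , inj₁ (negative⁻¹ (- 1ℚ))
  ; U-inhabited = let open Improve {N} 0≤N {0ℚ} ≤-refl in
      c , 0<c , -<0 0<c²-N
  ; L-lower = L-lower
  ; U-upper = λ { q<r (0<q , N<q²) →
      <-trans 0<q q<r , <-trans N<q² (square-mono-< (<⇒≤ 0<q) q<r) }
  ; L-open = L-open
  ; U-open = λ { (0<q , N<q²) → let open Improve {N} 0≤N (<⇒≤ 0<q)
                                    (q′<q , N<q′²) = upper N<q² in
      q′ , q′<q , q′-pos 0<q , N<q′² }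
  ; disjoint = λ { (inj₁ q<0) (0<q , _) → <-asym q<0 0<q
                 ; (inj₂ q²<N) (_ , N<q²) → <-asym q²<N N<q² }
  ; located = located
  }
  where
  N : ℚ
  N = + n / 1

  0≤N : 0ℚ ≤ N
  0≤N = 0≤ℕ n

  L U : ℚ → Set
  L q = q < 0ℚ ⊎ q * q < N
  U q = 0ℚ < q × N < q * q

  L-lower : ∀ {q r} → q < r → L r → L q
  L-lower q<r (inj₁ r<0) = inj₁ (<-trans q<r r<0)
  L-lower {q} q<r (inj₂ r²<N) with q <? 0ℚ
  ... | yes q<0 = inj₁ q<0
  ... | no q≮0 = inj₂ (<-trans (square-mono-< (≮⇒≥ q≮0) q<r) r²<N)

  L-open : ∀ {q} → L q → ∃ λ r → q < r × L r
  L-open (inj₁ q<0) = let (r , q<r , r<0) = <-dense q<0 in r , q<r , inj₁ r<0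
  L-open {q} (inj₂ q²<N) with q <? 0ℚ
  ... | yes q<0 = let (r , q<r , r<0) = <-dense q<0 in r , q<r , inj₁ r<0
  ... | no q≮0 = let open Improve {N} 0≤N (≮⇒≥ q≮0)
                     (q<q′ , q′²<N) = lower q²<N in
    q′ , q<q′ , inj₂ q′²<N

  located : ∀ {q r} → q < r → L q ⊎ U r
  located {q} q<r with q <? 0ℚ | q * q <? N
  ... | yes q<0 | _ = inj₁ (inj₁ q<0)
  ... | no _ | yes q²<N = inj₁ (inj₂ q²<N)
  ... | no q≮0 | no q²≮N = inj₂
    ( ≤-<-trans (≮⇒≥ q≮0) q<r
    , ≤-<-trans (≮⇒≥ q²≮N) (square-mono-< (≮⇒≥ q≮0) q<r) )

infix 8 √_

IsFloor : ℤ → ℝ → Set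
IsFloor k x = fromℤ k ≤ᴿ x × x <ᴿ fromℤ (+ 1 ℤ.+ k)

bump : ℕ → ℕ → ℕ
bump r n with suc r ℕ.* suc r ℕ.≤? n
... | yes _ = suc r
... | no  _ = r

isqrt : ℕ → ℕ
isqrt zero = 0
isqrt (suc n) = bump (isqrt n) (suc n)

isqrt-lower : ∀ n → isqrt n ℕ.* isqrt n ℕ.≤ n
isqrt-lower zero = ℕ.z≤n
isqrt-lower (suc n) with suc (isqrt n) ℕ.* suc (isqrt n) ℕ.≤? suc n
... | yes p = p
... | no  _ = ℕ.m≤n⇒m≤1+n (isqrt-lower n)

isqrt-upper : ∀ n → n ℕ.< suc (isqrt n) ℕ.* suc (isqrt n)
isqrt-upper zero = ℕ.s≤s ℕ.z≤n
isqrt-upper (suc n) with suc (isqrt n) ℕ.* suc (isqrt n) ℕ.≤? suc n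
... | yes _ = ℕ.≤-<-trans (isqrt-upper n)
                (ℕ.*-mono-< (ℕ.n<1+n (suc (isqrt n))) (ℕ.n<1+n (suc (isqrt n))))
... | no ¬p = ℕ.≰⇒> ¬p

/1-* : ∀ m n → (+ m / 1) * (+ n / 1) ≡ + (m ℕ.* n) / 1
/1-* m n = toℚᵘ-injective (ℚᵘ.≃-trans (toℚᵘ-homo-* (+ m / 1) (+ n / 1))
  (ℚᵘ.≃-trans (ℚᵘ.*-cong (toℚᵘ-fromℚᵘ (ℚᵘ.mkℚᵘ (+ m) 0)) (toℚᵘ-fromℚᵘ (ℚᵘ.mkℚᵘ (+ n) 0)))
  (ℚᵘ.≃-trans (ℚᵘ.*≡* (cong (ℤ._* + 1) (sym (ℤ.pos-* m n))))
  (ℚᵘ.≃-sym (toℚᵘ-fromℚᵘ (ℚᵘ.mkℚᵘ (+ (m ℕ.* n)) 0))))))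

/1-mono-≤ : ∀ {m n} → m ℕ.≤ n → + m / 1 ≤ + n / 1
/1-mono-≤ {m} {n} m≤n = toℚᵘ-cancel-≤
  (ℚᵘ.≤-respˡ-≃ (ℚᵘ.≃-sym (toℚᵘ-fromℚᵘ (ℚᵘ.mkℚᵘ (+ m) 0)))
  (ℚᵘ.≤-respʳ-≃ (ℚᵘ.≃-sym (toℚᵘ-fromℚᵘ (ℚᵘ.mkℚᵘ (+ n) 0)))
  (ℚᵘ.*≤* (ℤ.*-monoʳ-≤-nonNeg (+ 1) (ℤ.+≤+ m≤n)))))

/1-mono-< : ∀ {m n} → m ℕ.< n → + m / 1 < + n / 1
/1-mono-< {m} {n} m<n = toℚᵘ-cancel-<
  (ℚᵘ.<-respˡ-≃ (ℚᵘ.≃-sym (toℚᵘ-fromℚᵘ (ℚᵘ.mkℚᵘ (+ m) 0)))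
  (ℚᵘ.<-respʳ-≃ (ℚᵘ.≃-sym (toℚᵘ-fromℚᵘ (ℚᵘ.mkℚᵘ (+ n) 0)))
  (ℚᵘ.*<* (ℤ.*-monoʳ-<-pos (+ 1) (ℤ.+<+ m<n)))))

⌊√_⌋ : ℕ → ℤ
⌊√ n ⌋ = + isqrt n

⌊√⌋-isFloor : ∀ n → IsFloor ⌊√ n ⌋ (√ n)
⌊√⌋-isFloor n = below , above
  where
  k : ℕ
  k = isqrt n

  below : fromℤ (+ k) ≤ᴿ √ n
  below {q} q<k with q <? 0ℚ
  ... | yes q<0 = inj₁ q<0
  ... | no q≮0 = inj₂ (<-≤-trans
    (subst (q * q <_) (/1-* k k) (square-mono-< (≮⇒≥ q≮0) q<k))
    (/1-mono-≤ (isqrt-lower n)))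

  above : √ n <ᴿ fromℤ (+ suc k)
  above =
    let (r , r<k+1 , u) = ℝ.U-open (√ n) {+ suc k / 1}
          ( /1-mono-< {0} {suc k} ℕ.z<s
          , subst (+ n / 1 <_) (sym (/1-* (suc k) (suc k))) (/1-mono-< (isqrt-upper n)) )
    in r , u , r<k+1

{-# OPTIONS --safe #-}

-- Let S be the ±1 skew matrix of G, let Γ have size s, and let u x be the sum
-- of S x y over y in Γ.  Double regularity gives SᵀS = vI − J, so Σ u² = vs − s²
-- over all vertices.  On Γ the scores are s−1, s−3, …, −(s−1), so Σ u² = (s³ − s)/3.
-- As the sum over the vertices outside Γ is nonnegative, (s+1)(s+2) ≤ 12m.  If s is
-- odd, the scores outside Γ are odd, hence u² ≥ 1 there, and this improves
-- the bound to (s+2)² ≤ 1 + 12m.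
module Submission where

import Algebra.Properties.Semiring.Sum
open import Data.Bool.Base using (Bool; true; false; _∧_)
open import Data.Fin.Base using (Fin; zero; suc)
open import Data.Fin.Properties using () renaming (_≟_ to _≟ᶠ_)
open import Data.Fin.Subset using (Subset; inside; outside; ∣_∣; _∩_; _∈_)
open import Data.Integer.Base as ℤ using (ℤ; +_; -_; _+_; _≤_; _-_; _*_; 0ℤ; 1ℤ; -1ℤ; +≤+)
open import Data.Integer.Divisibility using (_∣_)
import Data.Integer.Properties as ℤ
open import Data.Integer.Tactic.RingSolver using (solve-∀)
open import Data.Nat.Base as ℕ using (ℕ; zero; suc)
import Data.Nat.DivMod as ℕ
import Data.Nat.Divisibility as ℕ
import Data.Nat.Properties as ℕ
import Data.Nat.Tactic.RingSolver as ℕ-Solver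
open import Data.Product.Base using (_×_; ∃; _,_; proj₁; proj₂)
import Data.Rational.Base as ℚ
import Data.Rational.Properties as ℚ
open import Data.Rational.Solver using (module +-*-Solver)
import Data.Rational.Unnormalised.Base as ℚᵘ
import Data.Rational.Unnormalised.Properties as ℚᵘ
open import Data.Sum.Base using (_⊎_; inj₁; inj₂)
open import Data.Vec.Base using ([]; _∷_; lookup; tabulate)
open import Data.Vec.Properties using (lookup∘tabulate; lookup-zipWith; lookup⇒[]=)
open import Function.Base using (_∘_)
open import Relation.Binary.PropositionalEquality
  using (_≡_; _≢_; refl; sym; trans; cong; cong₂; subst; subst₂; ≢-sym; module ≡-Reasoning)
open import Relation.Nullary using (¬_; yes; no; does; contradiction)
open import Relation.Nullary.Decidable using (dec-true; dec-false)
open import Defs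
  using (Tournament; IsDoublyRegular; IsTransitiveTournament; TransitiveSubtournament;
    fromℤ; √_; ⌊√_⌋; _⊕_; _÷2; _≤ᴿ_; _<ᴿ_; _≃ᴿ_; module ℝ;
    isqrt; isqrt-upper; ⌊√⌋-isFloor; /1-*; /1-mono-≤; /1-mono-<)

open Algebra.Properties.Semiring.Sum ℤ.+-*-semiring
  using (sum; sum-cong-≗; sum-replicate-zero; ∑-distrib-+; ∑-comm; *-distribˡ-sum; *-distribʳ-sum)

-- Indicators and finite integer sums.

ι : Bool → ℤ
ι true  = 1ℤ
ι false = 0ℤ

ι-idem : ∀ b → ι b * ι b ≡ ι b
ι-idem true  = refl
ι-idem false = refl

ι-∧ : ∀ b c → ι (b ∧ c) ≡ ι b * ι c
ι-∧ true  c = sym (ℤ.*-identityˡ (ι c))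
ι-∧ false c = refl

δ : ∀ {n} → Fin n → Fin n → ℤ
δ x y = ι (does (x ≟ᶠ y))

δ-refl : ∀ {n} (x : Fin n) → δ x x ≡ 1ℤ
δ-refl x = cong ι (dec-true (x ≟ᶠ x) refl)

δ-≢ : ∀ {n} {x y : Fin n} → x ≢ y → δ x y ≡ 0ℤ
δ-≢ {x = x} {y} x≢y = cong ι (dec-false (x ≟ᶠ y) x≢y)

sum-linear : ∀ {n} a b (f h : Fin n → ℤ) →
             sum (λ x → a * f x + b * h x) ≡ a * sum f + b * sum h
sum-linear a b f h = trans (∑-distrib-+ (λ x → a * f x) (λ x → b * h x))
  (cong₂ _+_ (sym (*-distribˡ-sum a f)) (sym (*-distribˡ-sum b h)))

sum-one : ∀ n → sum {n} (λ _ → 1ℤ) ≡ + n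
sum-one zero    = refl
sum-one (suc n) = cong (λ k → 1ℤ + k) (sum-one n)

sum-δ : ∀ {n} (x : Fin n) (f : Fin n → ℤ) → sum (λ y → δ x y * f y) ≡ f x
sum-δ {suc n} zero f = trans (cong₂ _+_ (ℤ.*-identityˡ (f zero)) (sum-replicate-zero n)) (ℤ.+-identityʳ (f zero))
sum-δ {suc n} (suc x) f = trans (ℤ.+-identityˡ _) (sum-δ x (f ∘ suc))

sum-mono-≤ : ∀ {n} {f h : Fin n → ℤ} → (∀ x → f x ≤ h x) → sum f ≤ sum h
sum-mono-≤ {zero}  f≤h = ℤ.≤-refl
sum-mono-≤ {suc n} f≤h = ℤ.+-mono-≤ (f≤h zero) (sum-mono-≤ (f≤h ∘ suc))

sum-*-sum : ∀ {m n} (f : Fin m → ℤ) (h : Fin n → ℤ) →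
            sum f * sum h ≡ sum (λ x → sum (λ y → f x * h y))
sum-*-sum f h = trans (*-distribʳ-sum (sum h) f) (sum-cong-≗ (λ x → *-distribˡ-sum (f x) h))

-- A triple sum is unchanged by cyclically permuting its variables; two interchanges of adjacent
-- sums realise this.
sum-rotate : ∀ {n} (f : Fin n → Fin n → Fin n → ℤ) →
             sum (λ x → sum (λ y → sum (λ z → f x y z))) ≡ sum (λ x → sum (λ y → sum (λ z → f y z x)))
sum-rotate f = sym (trans (∑-comm (λ x y → sum (λ z → f y z x)))
  (sum-cong-≗ (λ y → ∑-comm (λ x z → f y z x))))

∣p∣≡sum : ∀ {n} (p : Subset n) → + ∣ p ∣ ≡ sum (λ x → ι (lookup p x))
∣p∣≡sum []            = refl
∣p∣≡sum (outside ∷ p) = trans (∣p∣≡sum p) (sym (ℤ.+-identityˡ _))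
∣p∣≡sum (inside ∷ p)  = cong (λ k → 1ℤ + k) (∣p∣≡sum p)

∣tabulate∣≡sum : ∀ {n} (b : Fin n → Bool) → + ∣ tabulate b ∣ ≡ sum (λ x → ι (b x))
∣tabulate∣≡sum b = trans (∣p∣≡sum (tabulate b)) (sum-cong-≗ (λ x → cong ι (lookup∘tabulate b x)))

∣tabulate∩tabulate∣≡sum : ∀ {n} (b c : Fin n → Bool) →
                          + ∣ tabulate b ∩ tabulate c ∣ ≡ sum (λ x → ι (b x) * ι (c x))
∣tabulate∩tabulate∣≡sum b c = trans (∣p∣≡sum (tabulate b ∩ tabulate c)) (sum-cong-≗ (λ x →
  trans (cong ι (trans (lookup-zipWith _∧_ x (tabulate b) (tabulate c))
                       (cong₂ _∧_ (lookup∘tabulate b x) (lookup∘tabulate c x))))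
        (ι-∧ (b x) (c x))))

-- Quadratic sums for a matrix S applied to a 0/1 vector g.

module _ {v} (S : Fin v → Fin v → ℤ) (g : Fin v → ℤ) where

  score : Fin v → ℤ
  score x = sum (λ y → S x y * g y)

  score² : ∀ x → score x * score x ≡ sum (λ y → sum (λ z → g y * g z * (S x y * S x z)))
  score² x = trans (sum-*-sum (λ y → S x y * g y) (λ z → S x z * g z))
    (sum-cong-≗ (λ y → sum-cong-≗ (λ z → eq (S x y) (S x z) (g y) (g z))))
    where
    eq : ∀ a b c d → a * c * (b * d) ≡ c * d * (a * b)
    eq = solve-∀

  module _ (g-idem : ∀ y → g y * g y ≡ g y) where

    open ≡-Reasoning

    -- The hypothesis reads SᵀS = cI - J, so the sum is the quadratic form gᵀ(cI - J)g; idempotence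
    -- turns the sum of g² into `sum g`.
    sum-score² : ∀ c → (∀ y z → sum (λ x → S x y * S x z) ≡ c * δ y z - 1ℤ) →
                 sum (λ x → score x * score x) ≡ c * sum g - sum g * sum g
    sum-score² c gram = begin
      sum (λ x → score x * score x)
        ≡⟨ sum-cong-≗ score² ⟩
      sum (λ x → sum (λ y → sum (λ z → g y * g z * (S x y * S x z))))
        -- Two rotations make the sum over x innermost, where `gram` evaluates it.
        ≡⟨ sum-rotate (λ x y z → g y * g z * (S x y * S x z)) ⟩
      sum (λ z → sum (λ x → sum (λ y → g y * g z * (S x y * S x z))))
        ≡⟨ sum-rotate (λ z x y → g y * g z * (S x y * S x z)) ⟩
      sum (λ y → sum (λ z → sum (λ x → g y * g z * (S x y * S x z))))
        ≡⟨ sum-cong-≗ (λ y → sum-cong-≗ (λ z → sym (*-distribˡ-sum (g y * g z) (λ x → S x y * S x z)))) ⟩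
      sum (λ y → sum (λ z → g y * g z * sum (λ x → S x y * S x z)))
        ≡⟨ sum-cong-≗ (λ y → sum-cong-≗ (λ z →
             trans (cong (g y * g z *_) (gram y z)) (eq₁ (g y) (g z) (δ y z) c))) ⟩
      sum (λ y → sum (λ z → (c * g y) * (δ y z * g z) + (- g y) * g z))
        ≡⟨ sum-cong-≗ (λ y → trans (sum-linear (c * g y) (- g y) (λ z → δ y z * g z) g)
             (cong (λ e → c * g y * e + (- g y) * sum g) (sum-δ y g))) ⟩
      sum (λ y → c * g y * g y + (- g y) * sum g)
        ≡⟨ sum-cong-≗ (λ y → trans (eq₂ (g y) c (sum g))
             (cong (λ e → c * e + (- sum g) * g y) (g-idem y))) ⟩
      sum (λ y → c * g y + (- sum g) * g y)
        ≡⟨ sum-linear c (- sum g) g g ⟩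
      c * sum g + (- sum g) * sum g
        ≡⟨ cong (λ e → c * sum g + e) (sym (ℤ.neg-distribˡ-* (sum g) (sum g))) ⟩
      c * sum g - sum g * sum g ∎
      where
      eq₁ : ∀ a b d c → a * b * (c * d - 1ℤ) ≡ (c * a) * (d * b) + (- a) * b
      eq₁ = solve-∀
      eq₂ : ∀ a c t → c * a * a + (- a) * t ≡ c * (a * a) + (- t) * a
      eq₂ = solve-∀

    -- The sum is one over triples (x, y, z); adding its three rotations makes
    -- the summand constant off the diagonal, so that no ranking of the support
    -- of g is needed.
    sum-cyclic : (∀ x y z → g x ≡ 1ℤ → g y ≡ 1ℤ → g z ≡ 1ℤ →
                  S x y * S x z + S y z * S y x + S z x * S z y ≡ 1ℤ - δ x y * δ x z) →
                 (∀ x → g x ≡ 0ℤ ⊎ g x ≡ 1ℤ) →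
                 + 3 * sum (λ x → g x * (score x * score x)) ≡ sum g * sum g * sum g - sum g
    sum-cyclic cyclic g01 = begin
      + 3 * sum (λ x → g x * (score x * score x))
        ≡⟨ cong (+ 3 *_) (sum-cong-≗ (λ x → trans (cong (g x *_) (score² x))
             (trans (*-distribˡ-sum (g x) (λ y → sum (λ z → g y * g z * (S x y * S x z)))) (sum-cong-≗ (λ y →
             *-distribˡ-sum (g x) (λ z → g y * g z * (S x y * S x z))))))) ⟩
      + 3 * Σ³ T
        ≡⟨ eq₃ (Σ³ T) ⟩
      Σ³ T + Σ³ T + Σ³ T
        ≡⟨ cong₂ (λ a b → Σ³ T + a + b) (sum-rotate T)
             (trans (sum-rotate T) (sum-rotate (λ x y z → T y z x))) ⟩
      Σ³ T + Σ³ (λ x y z → T y z x) + Σ³ (λ x y z → T z x y)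
        ≡⟨ sym (trans (Σ³-+ _ _) (cong (_+ Σ³ (λ x y z → T z x y)) (Σ³-+ _ _))) ⟩
      Σ³ (λ x y z → T x y z + T y z x + T z x y)
        ≡⟨ sum-cong-≗ (λ x → sum-cong-≗ (λ y → sum-cong-≗ (λ z → rotations x y z))) ⟩
      Σ³ (λ x y z → g x * g y * g z + -1ℤ * (g x * (δ x y * g y) * (δ x z * g z)))
        -- The first term sums to the cube of `sum g`; the second lives on x = y = z and contributes
        -- - `sum g`.
        ≡⟨ sum-cong-≗ (λ x → trans (sum-cong-≗ (inner x)) (middle x)) ⟩
      sum (λ x → (sum g * sum g) * g x + -1ℤ * g x)
        ≡⟨ sum-linear (sum g * sum g) -1ℤ g g ⟩
      sum g * sum g * sum g + -1ℤ * sum g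
        ≡⟨ cong (λ e → sum g * sum g * sum g + e) (ℤ.-1*i≡-i (sum g)) ⟩
      sum g * sum g * sum g - sum g ∎
      where
      Σ³ : (Fin v → Fin v → Fin v → ℤ) → ℤ
      Σ³ f = sum (λ x → sum (λ y → sum (λ z → f x y z)))

      T : Fin v → Fin v → Fin v → ℤ
      T x y z = g x * (g y * g z * (S x y * S x z))

      Σ³-+ : ∀ f h → Σ³ (λ x y z → f x y z + h x y z) ≡ Σ³ f + Σ³ h
      Σ³-+ f h = trans
        (sum-cong-≗ (λ x → trans (sum-cong-≗ (λ y → ∑-distrib-+ (f x y) (h x y)))
                                 (∑-distrib-+ (λ y → sum (f x y)) (λ y → sum (h x y)))))
        (∑-distrib-+ (λ x → sum (λ y → sum (f x y))) (λ x → sum (λ y → sum (h x y))))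

      eq₃ : ∀ t → + 3 * t ≡ t + t + t
      eq₃ = solve-∀

      factor : ∀ a b c p q r → a * (b * c * p) + b * (c * a * q) + c * (a * b * r) ≡ a * b * c * (p + q + r)
      factor = solve-∀

      expand : ∀ a b c p q → a * b * c * (1ℤ - p * q) ≡ a * b * c + -1ℤ * (a * (p * b) * (q * c))
      expand = solve-∀

      -- `cyclic` is available only on the support of g; if one of the three weights is 0, both
      -- sides vanish.
      weighted : ∀ x y z → g x * g y * g z * (S x y * S x z + S y z * S y x + S z x * S z y)
                         ≡ g x * g y * g z * (1ℤ - δ x y * δ x z)
      weighted x y z with g01 x | g01 y | g01 z
      ... | inj₁ e | _ | _ rewrite e = refl
      ... | inj₂ _ | inj₁ e | _ rewrite e | ℤ.*-zeroʳ (g x) = refl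
      ... | inj₂ _ | inj₂ _ | inj₁ e rewrite e | ℤ.*-zeroʳ (g x * g y) = refl
      ... | inj₂ e | inj₂ e′ | inj₂ e″ = cong (g x * g y * g z *_) (cyclic x y z e e′ e″)

      rotations : ∀ x y z → T x y z + T y z x + T z x y
                          ≡ g x * g y * g z + -1ℤ * (g x * (δ x y * g y) * (δ x z * g z))
      rotations x y z = trans
        (factor (g x) (g y) (g z) (S x y * S x z) (S y z * S y x) (S z x * S z y))
        (trans (weighted x y z) (expand (g x) (g y) (g z) (δ x y) (δ x z)))

      inner : ∀ x y → sum (λ z → g x * g y * g z + -1ℤ * (g x * (δ x y * g y) * (δ x z * g z)))
                    ≡ (g x * sum g) * g y + (- (g x * g x)) * (δ x y * g y)
      inner x y = begin
        sum (λ z → g x * g y * g z + -1ℤ * (g x * (δ x y * g y) * (δ x z * g z)))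
          ≡⟨ sum-cong-≗ (λ z → eq₄ (g x * g y * g z) (g x * (δ x y * g y)) (δ x z * g z)) ⟩
        sum (λ z → g x * g y * g z + (- (g x * (δ x y * g y))) * (δ x z * g z))
          ≡⟨ sum-linear (g x * g y) (- (g x * (δ x y * g y))) g (λ z → δ x z * g z) ⟩
        g x * g y * sum g + (- (g x * (δ x y * g y))) * sum (λ z → δ x z * g z)
          ≡⟨ cong (λ e → g x * g y * sum g + (- (g x * (δ x y * g y))) * e) (sum-δ x g) ⟩
        g x * g y * sum g + (- (g x * (δ x y * g y))) * g x
          ≡⟨ eq₅ (g x) (g y) (sum g) (δ x y) ⟩
        (g x * sum g) * g y + (- (g x * g x)) * (δ x y * g y) ∎
        where
        eq₄ : ∀ a b c → a + -1ℤ * (b * c) ≡ a + (- b) * c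
        eq₄ = solve-∀
        eq₅ : ∀ a b t d → a * b * t + (- (a * (d * b))) * a ≡ (a * t) * b + (- (a * a)) * (d * b)
        eq₅ = solve-∀

      middle : ∀ x → sum (λ y → (g x * sum g) * g y + (- (g x * g x)) * (δ x y * g y))
                   ≡ (sum g * sum g) * g x + -1ℤ * g x
      middle x = begin
        sum (λ y → (g x * sum g) * g y + (- (g x * g x)) * (δ x y * g y))
          ≡⟨ sum-linear (g x * sum g) (- (g x * g x)) g (λ y → δ x y * g y) ⟩
        (g x * sum g) * sum g + (- (g x * g x)) * sum (λ y → δ x y * g y)
          ≡⟨ cong₂ (λ a b → (g x * sum g) * sum g + (- a) * b) (g-idem x) (sum-δ x g) ⟩
        (g x * sum g) * sum g + (- g x) * g x
          ≡⟨ eq₆ (g x) (sum g) ⟩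
        (sum g * sum g) * g x + -1ℤ * (g x * g x)
          ≡⟨ cong (λ e → (sum g * sum g) * g x + -1ℤ * e) (g-idem x) ⟩
        (sum g * sum g) * g x + -1ℤ * g x ∎
        where
        eq₆ : ∀ a t → (a * t) * t + (- a) * a ≡ (t * t) * a + -1ℤ * (a * a)
        eq₆ = solve-∀

-- The skew matrix of a tournament.

module _ {v} (G : Tournament v) where

  open Tournament G
  open ≡-Reasoning

  -- With A the adjacency matrix, A + Aᵀ = J - I, so `skew` is A - Aᵀ. The form 2A + I - J avoids
  -- the transpose and is affine in A.
  adjacency skew : Fin v → Fin v → ℤ
  adjacency x y = ι (does (dominates? x y))
  skew x y = + 2 * adjacency x y + δ x y - 1ℤ

  dominates⇒¬dominated : ∀ {x y} → Dominates x y → x ≢ y × ¬ Dominates y x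
  dominates⇒¬dominated {x} {y} xy = x≢y , asym
    where
    x≢y : x ≢ y
    x≢y refl = loopless xy
    asym : ¬ Dominates y x
    asym yx with exactlyOne x≢y
    ... | inj₁ (_ , ¬yx) = ¬yx yx
    ... | inj₂ (¬xy , _) = ¬xy xy

  skew-diagonal : ∀ x → skew x x ≡ 0ℤ
  skew-diagonal x rewrite dec-false (dominates? x x) loopless | δ-refl x = refl

  skew-dominates : ∀ {x y} → Dominates x y → skew x y ≡ 1ℤ
  skew-dominates {x} {y} xy
    rewrite dec-true (dominates? x y) xy | δ-≢ (proj₁ (dominates⇒¬dominated xy)) = refl

  skew-dominated : ∀ {x y} → Dominates x y → skew y x ≡ -1ℤ
  skew-dominated {x} {y} xy
    rewrite dec-false (dominates? y x) (proj₂ (dominates⇒¬dominated xy))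
          | δ-≢ (proj₁ (dominates⇒¬dominated xy) ∘ sym) = refl

  trichotomy : ∀ x y → x ≡ y ⊎ Dominates x y ⊎ Dominates y x
  trichotomy x y with x ≟ᶠ y
  ... | yes x≡y = inj₁ x≡y
  ... | no x≢y with exactlyOne x≢y
  ...   | inj₁ (xy , _) = inj₂ (inj₁ xy)
  ...   | inj₂ (_ , yx) = inj₂ (inj₂ yx)

  skew-antisym : ∀ x y → skew x y ≡ - skew y x
  skew-antisym x y with trichotomy x y
  ... | inj₁ refl rewrite skew-diagonal x = refl
  ... | inj₂ (inj₁ xy) rewrite skew-dominates xy | skew-dominated xy = refl
  ... | inj₂ (inj₂ yx) rewrite skew-dominates yx | skew-dominated yx = refl

  skew² : ∀ x y → skew x y * skew x y ≡ 1ℤ - δ x y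
  skew² x y with trichotomy x y
  ... | inj₁ refl rewrite skew-diagonal x | δ-refl x = refl
  ... | inj₂ (inj₁ xy) rewrite skew-dominates xy | δ-≢ (proj₁ (dominates⇒¬dominated xy)) = refl
  ... | inj₂ (inj₂ yx)
    rewrite skew-dominated yx | δ-≢ (proj₁ (dominates⇒¬dominated yx) ∘ sym) = refl

  -- Read off from S = 2A + I - J: sums against S become sums against A, which count neighbours.
  sum-skew : ∀ x (h : Fin v → ℤ) →
             sum (λ y → skew x y * h y) ≡ + 2 * sum (λ y → adjacency x y * h y) + h x - sum h
  sum-skew x h = begin
    sum (λ y → skew x y * h y)
      ≡⟨ sum-cong-≗ (λ y → eq (adjacency x y) (δ x y) (h y)) ⟩
    sum (λ y → + 2 * (adjacency x y * h y) + 1ℤ * (δ x y * h y + -1ℤ * h y))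
      ≡⟨ sum-linear (+ 2) 1ℤ (λ y → adjacency x y * h y) (λ y → δ x y * h y + -1ℤ * h y) ⟩
    + 2 * sum (λ y → adjacency x y * h y) + 1ℤ * sum (λ y → δ x y * h y + -1ℤ * h y)
      ≡⟨ cong (λ e → + 2 * sum (λ y → adjacency x y * h y) + 1ℤ * e)
           (trans (∑-distrib-+ (λ y → δ x y * h y) (λ y → -1ℤ * h y))
             (cong₂ _+_ (sum-δ x h) (sym (*-distribˡ-sum -1ℤ h)))) ⟩
    + 2 * sum (λ y → adjacency x y * h y) + 1ℤ * (h x + -1ℤ * sum h)
      ≡⟨ eq′ (sum (λ y → adjacency x y * h y)) (h x) (sum h) ⟩
    + 2 * sum (λ y → adjacency x y * h y) + h x - sum h ∎
    where
    eq : ∀ a d h → (+ 2 * a + d - 1ℤ) * h ≡ + 2 * (a * h) + 1ℤ * (d * h + -1ℤ * h)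
    eq = solve-∀
    eq′ : ∀ a h t → + 2 * a + 1ℤ * (h + -1ℤ * t) ≡ + 2 * a + h - t
    eq′ = solve-∀

  -- In a transitive triple the source and the sink each contribute 1 and the middle vertex -1. If
  -- exactly two of the vertices coincide, one square of ±1 remains; if all three do, everything is
  -- 0.
  skew-cyclic : ∀ x y z →
                ¬ (Dominates x y × Dominates y z × Dominates z x) →
                ¬ (Dominates y x × Dominates z y × Dominates x z) →
                skew x y * skew x z + skew y z * skew y x + skew z x * skew z y ≡ 1ℤ - δ x y * δ x z
  skew-cyclic x y z ¬c ¬c′
    -- Only `skew x y`, `skew y z` and `skew z x` remain, so one trichotomy per pair decides every
    -- sign.
    rewrite skew-antisym x z | skew-antisym y x | skew-antisym z y =
    signs (trichotomy x y) (trichotomy y z) (trichotomy z x)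
    where
    neg*neg : ∀ a → - a * - a ≡ a * a
    neg*neg = solve-∀

    δ*-zero : x ≢ y → 1ℤ ≡ 1ℤ - δ x y * δ x z
    δ*-zero x≢y = cong (λ e → 1ℤ - e * δ x z) (sym (δ-≢ x≢y))

    distinct : ∀ {x y} → Dominates x y → x ≢ y
    distinct = proj₁ ∘ dominates⇒¬dominated

    signs : x ≡ y ⊎ Dominates x y ⊎ Dominates y x →
            y ≡ z ⊎ Dominates y z ⊎ Dominates z y →
            z ≡ x ⊎ Dominates z x ⊎ Dominates x z →
            skew x y * - skew z x + skew y z * - skew x y + skew z x * - skew y z ≡ 1ℤ - δ x y * δ x z
    -- For x = y only the square of `skew x z` survives; `skew²` also covers z = x.
    signs (inj₁ refl) _ _
      rewrite skew-diagonal x | δ-refl x | skew-antisym z x | ℤ.*-zeroʳ (skew x z)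
            | ℤ.*-identityˡ (δ x z) | neg*neg (skew x z) | skew² x z = ℤ.+-identityˡ (1ℤ - δ x z)
    signs (inj₂ (inj₁ xy)) (inj₁ refl) _
      rewrite skew-diagonal y | skew-dominates xy | skew-dominated xy = δ*-zero (distinct xy)
    signs (inj₂ (inj₂ yx)) (inj₁ refl) _
      rewrite skew-diagonal y | skew-dominates yx | skew-dominated yx = δ*-zero (distinct yx ∘ sym)
    signs (inj₂ (inj₁ xy)) (inj₂ _) (inj₁ refl)
      rewrite skew-diagonal x | skew-dominates xy | skew-dominated xy = δ*-zero (distinct xy)
    signs (inj₂ (inj₂ yx)) (inj₂ _) (inj₁ refl)
      rewrite skew-diagonal x | skew-dominates yx | skew-dominated yx = δ*-zero (distinct yx ∘ sym)
    signs (inj₂ (inj₁ xy)) (inj₂ (inj₁ yz)) (inj₂ (inj₁ zx)) = contradiction (xy , yz , zx) ¬c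
    signs (inj₂ (inj₂ yx)) (inj₂ (inj₂ zy)) (inj₂ (inj₂ xz)) = contradiction (yx , zy , xz) ¬c′
    signs (inj₂ (inj₁ xy)) (inj₂ (inj₁ yz)) (inj₂ (inj₂ xz))
      rewrite skew-dominates xy | skew-dominates yz | skew-dominated xz = δ*-zero (distinct xy)
    signs (inj₂ (inj₁ xy)) (inj₂ (inj₂ zy)) (inj₂ (inj₁ zx))
      rewrite skew-dominates xy | skew-dominated zy | skew-dominates zx = δ*-zero (distinct xy)
    signs (inj₂ (inj₁ xy)) (inj₂ (inj₂ zy)) (inj₂ (inj₂ xz))
      rewrite skew-dominates xy | skew-dominated zy | skew-dominated xz = δ*-zero (distinct xy)
    signs (inj₂ (inj₂ yx)) (inj₂ (inj₁ yz)) (inj₂ (inj₁ zx))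
      rewrite skew-dominated yx | skew-dominates yz | skew-dominates zx = δ*-zero (distinct yx ∘ sym)
    signs (inj₂ (inj₂ yx)) (inj₂ (inj₁ yz)) (inj₂ (inj₂ xz))
      rewrite skew-dominated yx | skew-dominates yz | skew-dominated xz = δ*-zero (distinct yx ∘ sym)
    signs (inj₂ (inj₂ yx)) (inj₂ (inj₂ zy)) (inj₂ (inj₁ zx))
      rewrite skew-dominated yx | skew-dominated zy | skew-dominates zx = δ*-zero (distinct yx ∘ sym)

  -- The Gram matrix under double regularity.

  module _ (d k : ℤ)
           (outdegree : ∀ x → sum (adjacency x) ≡ d)
           (indegree : ∀ y → sum (λ x → adjacency x y) ≡ d)
           (common : ∀ {x y} → x ≢ y → sum (λ z → adjacency x z * adjacency y z) ≡ k)
           where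

    -- This is AAᵀ = kJ + (d - k)I: as A has entries 0 and 1, its diagonal entries are the
    -- out-degrees.
    common-δ : ∀ x y → sum (λ z → adjacency x z * adjacency y z) ≡ k + (d - k) * δ x y
    common-δ x y with x ≟ᶠ y
    ... | yes refl = trans (sum-cong-≗ (λ z → ι-idem (does (dominates? x z)))) (trans (outdegree x) (eq d k))
      where
      eq : ∀ d k → d ≡ k + (d - k) * 1ℤ
      eq = solve-∀
    ... | no x≢y = trans (common x≢y) (eq d k)
      where
      eq : ∀ d k → k ≡ k + (d - k) * 0ℤ
      eq = solve-∀

    -- Count the pairs (y, z) with z dominated by both x and y in two ways.
    degree² : Fin v → d * d ≡ + v * k + (d - k)
    degree² x = begin
      d * d
        ≡⟨ cong (_* d) (sym (outdegree x)) ⟩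
      sum (adjacency x) * d
        ≡⟨ *-distribʳ-sum d (adjacency x) ⟩
      sum (λ z → adjacency x z * d)
        ≡⟨ sum-cong-≗ (λ z → trans (cong (adjacency x z *_) (sym (indegree z)))
             (*-distribˡ-sum (adjacency x z) (λ y → adjacency y z))) ⟩
      sum (λ z → sum (λ y → adjacency x z * adjacency y z))
        ≡⟨ ∑-comm (λ z y → adjacency x z * adjacency y z) ⟩
      sum (λ y → sum (λ z → adjacency x z * adjacency y z))
        ≡⟨ sum-cong-≗ (λ y → trans (common-δ x y)
             (cong₂ _+_ (sym (ℤ.*-identityʳ k)) (cong ((d - k) *_) (sym (ℤ.*-identityʳ (δ x y)))))) ⟩
      sum (λ y → k * 1ℤ + (d - k) * (δ x y * 1ℤ))
        ≡⟨ sum-linear k (d - k) (λ _ → 1ℤ) (λ y → δ x y * 1ℤ) ⟩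
      k * sum {v} (λ _ → 1ℤ) + (d - k) * sum (λ y → δ x y * 1ℤ)
        ≡⟨ cong₂ _+_ (trans (cong (k *_) (sum-one v)) (ℤ.*-comm k (+ v)))
             (trans (cong ((d - k) *_) (sum-δ x (λ _ → 1ℤ))) (ℤ.*-identityʳ (d - k))) ⟩
      + v * k + (d - k) ∎

    module _ .{{_ : ℤ.NonZero d}} (v≡1+2d : + v ≡ 1ℤ + + 2 * d) where

      -- Putting v = 1 + 2d into `degree²` gives d² = d(1 + 2k), and d is cancelled. Equivalently, k
      -- = (v - 3)/4.
      degree≡1+2common : Fin v → d ≡ 1ℤ + + 2 * k
      degree≡1+2common x = ℤ.*-cancelˡ-≡ d d (1ℤ + + 2 * k)
        (trans (degree² x) (trans (cong (λ e → e * k + (d - k)) v≡1+2d) (eq d k)))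
        where
        eq : ∀ d k → (1ℤ + + 2 * d) * k + (d - k) ≡ d * (1ℤ + + 2 * k)
        eq = solve-∀

      -- SSᵀ = vI - J, by expanding both factors with `sum-skew`; the row sums of S vanish because v
      -- = 1 + 2d.
      skew-rows : ∀ x y → sum (λ z → skew x z * skew y z) ≡ + v * δ x y - 1ℤ
      skew-rows x y = begin
        sum (λ z → skew x z * skew y z)
          ≡⟨ sum-skew x (skew y) ⟩
        + 2 * sum (λ z → adjacency x z * skew y z) + skew y x - sum (skew y)
          ≡⟨ cong₂ (λ a b → + 2 * a + skew y x - b) inner row ⟩
        + 2 * (+ 2 * (k + (d - k) * δ x y) + adjacency x y - d) + skew y x - 0ℤ
          ≡⟨ eq₁ k d (δ x y) (adjacency x y) (skew y x) ⟩
        + 4 * k + + 4 * (d - k) * δ x y - + 2 * d + (+ 2 * adjacency x y + skew y x)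
          -- By antisymmetry the term 2A - S is J - I, so the orientation of the pair drops out.
          ≡⟨ cong (λ e → + 4 * k + + 4 * (d - k) * δ x y - + 2 * d + e)
               (trans (cong (λ e → + 2 * adjacency x y + e) (skew-antisym y x)) (eq₂ (adjacency x y) (δ x y))) ⟩
        + 4 * k + + 4 * (d - k) * δ x y - + 2 * d + (1ℤ - δ x y)
          -- Off the diagonal the value is 4k - 2d + 1, which d = 1 + 2k turns into -1.
          ≡⟨ cong (λ e → + 4 * k + + 4 * (e - k) * δ x y - + 2 * e + (1ℤ - δ x y)) d≡ ⟩
        + 4 * k + + 4 * (1ℤ + + 2 * k - k) * δ x y - + 2 * (1ℤ + + 2 * k) + (1ℤ - δ x y)
          ≡⟨ eq₃ k (δ x y) ⟩
        (1ℤ + + 2 * (1ℤ + + 2 * k)) * δ x y - 1ℤ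
          ≡⟨ cong (λ e → (1ℤ + + 2 * e) * δ x y - 1ℤ) (sym d≡) ⟩
        (1ℤ + + 2 * d) * δ x y - 1ℤ
          ≡⟨ cong (λ e → e * δ x y - 1ℤ) (sym v≡1+2d) ⟩
        + v * δ x y - 1ℤ ∎
        where
        d≡ : d ≡ 1ℤ + + 2 * k
        d≡ = degree≡1+2common x

        inner : sum (λ z → adjacency x z * skew y z) ≡ + 2 * (k + (d - k) * δ x y) + adjacency x y - d
        inner = begin
          sum (λ z → adjacency x z * skew y z)
            ≡⟨ sum-cong-≗ (λ z → ℤ.*-comm (adjacency x z) (skew y z)) ⟩
          sum (λ z → skew y z * adjacency x z)
            ≡⟨ sum-skew y (adjacency x) ⟩
          + 2 * sum (λ z → adjacency y z * adjacency x z) + adjacency x y - sum (adjacency x)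
            ≡⟨ cong₂ (λ a b → + 2 * a + adjacency x y - b)
                 (trans (sum-cong-≗ (λ z → ℤ.*-comm (adjacency y z) (adjacency x z))) (common-δ x y))
                 (outdegree x) ⟩
          + 2 * (k + (d - k) * δ x y) + adjacency x y - d ∎

        row : sum (skew y) ≡ 0ℤ
        row = begin
          sum (skew y)
            ≡⟨ sum-cong-≗ (λ z → sym (ℤ.*-identityʳ (skew y z))) ⟩
          sum (λ z → skew y z * 1ℤ)
            ≡⟨ sum-skew y (λ _ → 1ℤ) ⟩
          + 2 * sum (λ z → adjacency y z * 1ℤ) + 1ℤ - sum {v} (λ _ → 1ℤ)
            ≡⟨ cong₂ (λ a b → + 2 * a + 1ℤ - b)
                 (trans (sum-cong-≗ (λ z → ℤ.*-identityʳ (adjacency y z))) (outdegree y))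
                 (trans (sum-one v) v≡1+2d) ⟩
          + 2 * d + 1ℤ - (1ℤ + + 2 * d)
            ≡⟨ eq d ⟩
          0ℤ ∎
          where
          eq : ∀ d → + 2 * d + 1ℤ - (1ℤ + + 2 * d) ≡ 0ℤ
          eq = solve-∀

        eq₁ : ∀ k d e a t → + 2 * (+ 2 * (k + (d - k) * e) + a - d) + t - 0ℤ
                          ≡ + 4 * k + + 4 * (d - k) * e - + 2 * d + (+ 2 * a + t)
        eq₁ = solve-∀
        eq₂ : ∀ a e → + 2 * a + - (+ 2 * a + e - 1ℤ) ≡ 1ℤ - e
        eq₂ = solve-∀
        eq₃ : ∀ k e → + 4 * k + + 4 * (1ℤ + + 2 * k - k) * e - + 2 * (1ℤ + + 2 * k) + (1ℤ - e)
                    ≡ (1ℤ + + 2 * (1ℤ + + 2 * k)) * e - 1ℤ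
        eq₃ = solve-∀

      -- Antisymmetry carries SSᵀ over to SᵀS, the product that occurs in `sum-score²`.
      skew-columns : ∀ x y → sum (λ z → skew z x * skew z y) ≡ + v * δ x y - 1ℤ
      skew-columns x y = trans
        (sum-cong-≗ (λ z → trans (cong₂ _*_ (skew-antisym z x) (skew-antisym z y))
          (neg*neg (skew x z) (skew y z))))
        (skew-rows x y)
        where
        neg*neg : ∀ a b → - a * - b ≡ a * b
        neg*neg = solve-∀

-- Signs and parity of integers.

0≤i² : ∀ i → 0ℤ ≤ i * i
0≤i² (+ zero)     = +≤+ ℕ.z≤n
0≤i² (+ suc _)    = +≤+ ℕ.z≤n
0≤i² (ℤ.-[1+ _ ]) = +≤+ ℕ.z≤n

1≤i² : ∀ i → i ≢ 0ℤ → 1ℤ ≤ i * i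
1≤i² (+ zero) i≢0 = contradiction refl i≢0
1≤i² (+ suc n) i≢0 = +≤+ (ℕ.s≤s ℕ.z≤n)
1≤i² (ℤ.-[1+ n ]) i≢0 = +≤+ (ℕ.s≤s ℕ.z≤n)

2*i≢1 : ∀ i → + 2 * i ≢ 1ℤ
2*i≢1 i 2i≡1 = ℕ.even≢odd ℤ.∣ i ∣ 0 (trans (sym (ℤ.abs-* (+ 2) i)) (cong ℤ.∣_∣ 2i≡1))

0≤*-cancel : ∀ i j .{{_ : ℤ.Positive i}} → 0ℤ ≤ i * j → 0ℤ ≤ j
0≤*-cancel i j 0≤ij = ℤ.*-cancelˡ-≤-pos 0ℤ j i (subst (_≤ i * j) (sym (ℤ.*-zeroʳ i)) 0≤ij)

-- Size bounds for a transitive subtournament.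

module _ {m v s} (m≥1 : m ℕ.≥ 1) (v≡ : v ≡ 4 ℕ.* m ℕ.∸ 1)
         (G : Tournament v) (regular : IsDoublyRegular G) (Γ : TransitiveSubtournament G s) where

  private
    module R = IsDoublyRegular regular
    module Γ = TransitiveSubtournament Γ
  open Tournament G

  private
    -- The common in- and out-degree (v - 1)/2; the truncated subtraction is exact as m ≥ 1.
    d : ℕ
    d = 2 ℕ.* m ℕ.∸ 1

    1+v≡4m : suc v ≡ 4 ℕ.* m
    1+v≡4m = trans (cong suc v≡) (ℕ.m+[n∸m]≡n (ℕ.≤-trans m≥1 (ℕ.m≤m+n m (3 ℕ.* m))))

    1+d≡2m : suc d ≡ 2 ℕ.* m
    1+d≡2m = ℕ.m+[n∸m]≡n (ℕ.≤-trans m≥1 (ℕ.m≤m+n m (1 ℕ.* m)))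

    v≡1+2d : v ≡ 1 ℕ.+ 2 ℕ.* d
    v≡1+2d = ℕ.suc-injective (begin
      suc v                     ≡⟨ 1+v≡4m ⟩
      4 ℕ.* m                   ≡⟨ ℕ.*-assoc 2 2 m ⟩
      2 ℕ.* (2 ℕ.* m)           ≡⟨ cong (2 ℕ.*_) (sym 1+d≡2m) ⟩
      2 ℕ.* suc d               ≡⟨ ℕ.*-suc 2 d ⟩
      suc (1 ℕ.+ 2 ℕ.* d)       ∎)
      where open ≡-Reasoning

    instance
      -- `suc d` = 2m is even, hence not 1. This licenses the cancellation in `degree≡1+2common`.
      d-nonZero : ℤ.NonZero (+ d)
      d-nonZero = ℕ.≢-nonZero λ d≡0 → ℕ.even≢odd m 0 (trans (sym 1+d≡2m) (cong suc d≡0))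

    degree : ∀ {e} → 1 ℕ.+ 2 ℕ.* e ≡ v → e ≡ d
    degree {e} eq = ℕ.*-cancelˡ-≡ e d 2 (ℕ.suc-injective (trans eq v≡1+2d))

    +v≡1+2d : + v ≡ 1ℤ + + 2 * + d
    +v≡1+2d = trans (cong +_ v≡1+2d) (cong (λ e → 1ℤ + e) (ℤ.pos-* 2 d))

    +v≡4m-1 : + v ≡ + 4 * + m - 1ℤ
    +v≡4m-1 = begin
      + v               ≡⟨ eq (+ v) ⟩
      1ℤ + + v - 1ℤ     ≡⟨ cong (λ e → + e - 1ℤ) 1+v≡4m ⟩
      + (4 ℕ.* m) - 1ℤ  ≡⟨ cong (λ e → e - 1ℤ) (ℤ.pos-* 4 m) ⟩
      + 4 * + m - 1ℤ    ∎
      where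
      open ≡-Reasoning
      eq : ∀ i → i ≡ 1ℤ + i - 1ℤ
      eq = solve-∀

    outdegree : ∀ x → sum (adjacency G x) ≡ + d
    outdegree x = trans (sym (∣tabulate∣≡sum (λ y → does (dominates? x y))))
      (cong +_ (degree (R.outDegree x)))

    indegree : ∀ y → sum (λ x → adjacency G x y) ≡ + d
    indegree y = trans (sym (∣tabulate∣≡sum (λ x → does (dominates? x y))))
      (cong +_ (degree (R.inDegree y)))

    k : ℤ
    k = + proj₁ R.common

    common : ∀ {x y} → x ≢ y → sum (λ z → adjacency G x z * adjacency G y z) ≡ k
    common {x} {y} x≢y = trans
      (sym (∣tabulate∩tabulate∣≡sum (λ z → does (dominates? x z)) (λ z → does (dominates? y z))))
      (cong +_ (proj₂ R.common x≢y))

    g : Fin v → ℤ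
    g x = ι (lookup Γ.vertices x)

    g-idem : ∀ x → g x * g x ≡ g x
    g-idem x = ι-idem (lookup Γ.vertices x)

    sum-g : sum g ≡ + s
    sum-g = trans (sym (∣p∣≡sum Γ.vertices)) (cong +_ Γ.size)

    g01 : ∀ x → g x ≡ 0ℤ ⊎ g x ≡ 1ℤ
    g01 x with lookup Γ.vertices x
    ... | true  = inj₂ refl
    ... | false = inj₁ refl

    member : ∀ {x} → g x ≡ 1ℤ → x ∈ Γ.vertices
    member {x} gx≡1 = lookup⇒[]= x Γ.vertices (ι-inside (lookup Γ.vertices x) gx≡1)
      where
      ι-inside : ∀ b → ι b ≡ 1ℤ → b ≡ inside
      ι-inside true _ = refl

    -- Transitivity would turn a cyclic triangle in Γ into two vertices dominating each other.
    acyclic : ∀ {x y z} → g x ≡ 1ℤ → g y ≡ 1ℤ → g z ≡ 1ℤ →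
              ¬ (Dominates x y × Dominates y z × Dominates z x)
    acyclic gx gy gz (xy , yz , zx) =
      proj₂ (dominates⇒¬dominated G zx)
        (IsTransitiveTournament.transitive Γ.isTransitive {_ , member gx} {_ , member gy} {_ , member gz} xy yz)

    -- `u x` is the number of vertices of Γ that x dominates minus the number of those that dominate
    -- x.
    u : Fin v → ℤ
    u = score (skew G) g

    u² : sum (λ x → u x * u x) ≡ + v * + s - + s * + s
    u² = trans
      (sum-score² (skew G) g g-idem (+ v) (skew-columns G (+ d) k outdegree indegree common +v≡1+2d))
      (cong (λ e → + v * e - e * e) sum-g)

    gu² : + 3 * sum (λ x → g x * (u x * u x)) ≡ + s * + s * + s - + s
    gu² = trans
      (sum-cyclic (skew G) g g-idem
        (λ x y z gx gy gz → skew-cyclic G x y z (acyclic gx gy gz)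
          -- The opposite orientation is a cyclic triangle in the order x, z, y.
          (λ (yx , zy , xz) → acyclic gx gz gy (xz , zy , yx)))
        g01)
      (cong (λ e → e * e * e - e) sum-g)

    -- Each of the v - s vertices outside Γ contributes at least w to the sum of u². The factor 3
    -- avoids dividing s³ - s by 3.
    outside-bound : ∀ w → (∀ x → g x ≡ 0ℤ → w ≤ u x * u x) →
                    + 3 * (w * (+ v - + s)) ≤ + 3 * (+ v * + s - + s * + s) - (+ s * + s * + s - + s)
    outside-bound w w≤u² = begin
      + 3 * (w * (+ v - + s))
        ≡⟨ cong (+ 3 *_) (sym lhs) ⟩
      + 3 * sum (λ x → w * 1ℤ + (- w) * g x)
        ≤⟨ ℤ.*-monoˡ-≤-nonNeg (+ 3) (sum-mono-≤ pointwise) ⟩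
      + 3 * sum (λ x → 1ℤ * (u x * u x) + -1ℤ * (g x * (u x * u x)))
        ≡⟨ cong (+ 3 *_) (sum-linear 1ℤ -1ℤ (λ x → u x * u x) (λ x → g x * (u x * u x))) ⟩
      + 3 * (1ℤ * sum (λ x → u x * u x) + -1ℤ * sum (λ x → g x * (u x * u x)))
        ≡⟨ eq₁ (sum (λ x → u x * u x)) (sum (λ x → g x * (u x * u x))) ⟩
      + 3 * sum (λ x → u x * u x) - + 3 * sum (λ x → g x * (u x * u x))
        ≡⟨ cong₂ (λ a b → + 3 * a - b) u² gu² ⟩
      + 3 * (+ v * + s - + s * + s) - (+ s * + s * + s - + s) ∎
      where
      open ℤ.≤-Reasoning
      eq₁ : ∀ a b → + 3 * (1ℤ * a + -1ℤ * b) ≡ + 3 * a - + 3 * b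
      eq₁ = solve-∀
      eq₂ : ∀ w v s → w * v + (- w) * s ≡ w * (v - s)
      eq₂ = solve-∀
      eq₃ : ∀ w → w * 1ℤ + (- w) * 0ℤ ≡ w
      eq₃ = solve-∀
      eq₄ : ∀ a → a ≡ 1ℤ * a + -1ℤ * (0ℤ * a)
      eq₄ = solve-∀
      eq₅ : ∀ w a → w * 1ℤ + (- w) * 1ℤ ≡ 1ℤ * a + -1ℤ * (1ℤ * a)
      eq₅ = solve-∀

      lhs : sum (λ x → w * 1ℤ + (- w) * g x) ≡ w * (+ v - + s)
      lhs = trans (sum-linear w (- w) (λ _ → 1ℤ) g)
        (trans (cong₂ (λ a b → w * a + (- w) * b) (sum-one v) sum-g) (eq₂ w (+ v) (+ s)))

      pointwise : ∀ x → w * 1ℤ + (- w) * g x ≤ 1ℤ * (u x * u x) + -1ℤ * (g x * (u x * u x))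
      pointwise x with g01 x
      ... | inj₁ gx≡0 rewrite gx≡0 = subst₂ _≤_ (sym (eq₃ w)) (eq₄ (u x * u x)) (w≤u² x gx≡0)
      ... | inj₂ gx≡1 rewrite gx≡1 = ℤ.≤-reflexive (eq₅ w (u x * u x))

    -- Outside Γ, `u x` = 2c - s with c the number of vertices of Γ dominated by x, so it is odd
    -- along with s; `u x` = 0 would give 2(c - j) = 1.
    u-odd : ∀ j → s ≡ 1 ℕ.+ j ℕ.* 2 → ∀ x → g x ≡ 0ℤ → 1ℤ ≤ u x * u x
    u-odd j s≡1+2j x gx≡0 = 1≤i² (u x) λ ux≡0 → 2*i≢1 (c - + j) (begin
      + 2 * (c - + j)                   ≡⟨ eq c (+ j) ⟩
      1ℤ + (+ 2 * c + 0ℤ - (1ℤ + + j * + 2)) ≡⟨ cong (λ e → 1ℤ + e) (sym ux≡) ⟩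
      1ℤ + u x                          ≡⟨ cong (λ e → 1ℤ + e) ux≡0 ⟩
      1ℤ                                ∎)
      where
      open ≡-Reasoning
      c = sum (λ y → adjacency G x y * g y)
      eq : ∀ c j → + 2 * (c - j) ≡ 1ℤ + (+ 2 * c + 0ℤ - (1ℤ + j * + 2))
      eq = solve-∀
      +s≡ : + s ≡ 1ℤ + + j * + 2
      +s≡ = trans (cong +_ s≡1+2j) (cong (λ e → 1ℤ + e) (ℤ.pos-* j 2))
      ux≡ : u x ≡ + 2 * c + 0ℤ - (1ℤ + + j * + 2)
      ux≡ = trans (sum-skew G x g) (cong₂ (λ a b → + 2 * c + a - b) gx≡0 (trans sum-g +s≡))

    12m : + (12 ℕ.* m) ≡ + 12 * + m
    12m = ℤ.pos-* 12 m

  -- With w = 0 and v = 4m - 1 the outside bound factors as 0 ≤ s(12m - (s + 1)(s + 2)).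
  size-bound : suc s ℕ.* suc (suc s) ℕ.≤ 12 ℕ.* m
  size-bound = ℤ.drop‿+≤+ (subst₂ _≤_ (sym (ℤ.pos-* (suc s) (suc (suc s)))) (sym 12m) (positive-size s refl))
    where
    eq : ∀ m s → + 3 * ((+ 4 * m - 1ℤ) * s - s * s) - (s * s * s - s)
               ≡ s * (+ 12 * m - (1ℤ + s) * (+ 2 + s))
    eq = solve-∀
    positive-size : ∀ n → n ≡ s → (1ℤ + + n) * (+ 2 + + n) ≤ + 12 * + m
    -- For s = 0 the factor s cannot be cancelled, but the claim is just 2 ≤ 12m.
    positive-size zero _ = ℤ.≤-trans (+≤+ (ℕ.m≤m+n 2 10)) (ℤ.*-monoˡ-≤-nonNeg (+ 12) (+≤+ m≥1))
    positive-size n@(suc _) refl = ℤ.0≤i-j⇒j≤i (0≤*-cancel (+ n) _ (subst (0ℤ ≤_)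
      (trans (cong (λ e → + 3 * (e * + s - + s * + s) - (+ s * + s * + s - + s)) +v≡4m-1) (eq (+ m) (+ s)))
      (outside-bound 0ℤ (λ x _ → 0≤i² (u x)))))

  -- With w = 1 the outside bound factors as 0 ≤ (s - 1)(1 + 12m - (s + 2)²).
  odd-size-bound : ∀ j → s ≡ 1 ℕ.+ j ℕ.* 2 → suc (suc s) ℕ.* suc (suc s) ℕ.≤ 1 ℕ.+ 12 ℕ.* m
  -- For s = 1 the factor s - 1 vanishes; the claim is 9 ≤ 1 + 12m.
  odd-size-bound zero refl = ℕ.s≤s (ℕ.≤-trans (ℕ.m≤m+n 8 4) (ℕ.*-monoʳ-≤ 12 m≥1))
  odd-size-bound j@(suc i) s≡ = ℤ.drop‿+≤+ (subst₂ _≤_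
    (sym (ℤ.pos-* (suc (suc s)) (suc (suc s)))) (cong (λ e → 1ℤ + e) (sym 12m))
    (ℤ.0≤i-j⇒j≤i (0≤*-cancel (+ t) _ (subst (0ℤ ≤_) eq (ℤ.i≤j⇒0≤j-i (outside-bound 1ℤ (u-odd j s≡)))))))
    where
    t = j ℕ.* 2
    factor : ∀ m t → + 3 * ((+ 4 * m - 1ℤ) * (1ℤ + t) - (1ℤ + t) * (1ℤ + t))
                     - ((1ℤ + t) * (1ℤ + t) * (1ℤ + t) - (1ℤ + t))
                     - + 3 * (1ℤ * ((+ 4 * m - 1ℤ) - (1ℤ + t)))
                   ≡ t * (1ℤ + + 12 * m - (+ 2 + (1ℤ + t)) * (+ 2 + (1ℤ + t)))
    factor = solve-∀
    eq : + 3 * (+ v * + s - + s * + s) - (+ s * + s * + s - + s) - + 3 * (1ℤ * (+ v - + s))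
         ≡ + t * (1ℤ + + 12 * + m - (+ 2 + + s) * (+ 2 + + s))
    eq = trans
      (cong₂ (λ e a → + 3 * (e * a - a * a) - (a * a * a - a) - + 3 * (1ℤ * (e - a))) +v≡4m-1 (cong +_ s≡))
      (trans (factor (+ m) (+ t))
        (cong (λ a → + t * (1ℤ + + 12 * + m - (+ 2 + a) * (+ 2 + a))) (sym (cong +_ s≡))))

-- From Dedekind cuts to inequalities of natural numbers.

/1-+ : ∀ i j → i ℚ./ 1 ℚ.+ j ℚ./ 1 ≡ (i + j) ℚ./ 1
/1-+ i j = ℚ.toℚᵘ-injective (begin
  ℚ.toℚᵘ (i ℚ./ 1 ℚ.+ j ℚ./ 1)              ≈⟨ ℚ.toℚᵘ-homo-+ (i ℚ./ 1) (j ℚ./ 1) ⟩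
  ℚ.toℚᵘ (i ℚ./ 1) ℚᵘ.+ ℚ.toℚᵘ (j ℚ./ 1)    ≈⟨ ℚᵘ.+-cong (ℚ.toℚᵘ-fromℚᵘ (ℚᵘ.mkℚᵘ i 0)) (ℚ.toℚᵘ-fromℚᵘ (ℚᵘ.mkℚᵘ j 0)) ⟩
  ℚᵘ.mkℚᵘ i 0 ℚᵘ.+ ℚᵘ.mkℚᵘ j 0              ≈⟨ ℚᵘ.*≡* (cong (ℤ._* + 1) (cong₂ _+_ (ℤ.*-identityʳ i) (ℤ.*-identityʳ j))) ⟩
  ℚᵘ.mkℚᵘ (i + j) 0                         ≈⟨ ℚ.toℚᵘ-fromℚᵘ (ℚᵘ.mkℚᵘ (i + j) 0) ⟨
  ℚ.toℚᵘ ((i + j) ℚ./ 1)                    ∎)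
  where open ℚᵘ.≃-Reasoning

-- The lower cut of ε at 0 is that of √n at 0 - (-⌊√n⌋), which has to be recognised as ⌊√n⌋.
0-/1 : ∀ n → ℚ.0ℚ ℚ.- (- (+ n)) ℚ./ 1 ≡ + n ℚ./ 1
0-/1 zero    = refl
0-/1 (suc n) = solve 1 (λ p → con ℚ.0ℚ :- (:- p) := p) refl (+ suc n ℚ./ 1)
  where open +-*-Solver

-- If ⌊√n⌋² < n, then 0 lies in the lower cut of ε, and ε ≤ 0 would give 0 < 0.
fractional-part≤0⇒square : ∀ n → √ n ⊕ (- ⌊√ n ⌋) ≤ᴿ fromℤ (+ 0) → n ℕ.≤ isqrt n ℕ.* isqrt n
fractional-part≤0⇒square n ε≤0 = ℕ.≮⇒≥ λ f²<n → ℚ.<-irrefl refl (ε≤0 (inj₂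
  (subst₂ ℚ._<_
    (trans (sym (/1-* (isqrt n) (isqrt n))) (sym (cong₂ ℚ._*_ (0-/1 (isqrt n)) (0-/1 (isqrt n)))))
    refl (/1-mono-< f²<n))))

≤isqrt : ∀ {r n} → r ℕ.* r ℕ.≤ n → r ℕ.≤ isqrt n
≤isqrt {r} {n} r²≤n = ℕ.≮⇒≥ λ f<r → ℕ.<⇒≱ (isqrt-upper n) (ℕ.≤-trans (ℕ.*-mono-≤ f<r f<r) r²≤n)

2+≤isqrt⇒≤√-2 : ∀ {s n} → 2 ℕ.+ s ℕ.≤ isqrt n → fromℤ (+ s) ≤ᴿ √ n ⊕ - (+ 2)
2+≤isqrt⇒≤√-2 {s} {n} 2+s≤f {q} q<s = proj₁ (⌊√⌋-isFloor n)
  (ℚ.<-≤-trans (subst (q ℚ.+ + 2 ℚ./ 1 ℚ.<_) (/1-+ (+ s) (+ 2)) (ℚ.+-monoˡ-< (+ 2 ℚ./ 1) q<s))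
    (/1-mono-≤ (subst (ℕ._≤ isqrt n) (ℕ.+-comm 2 s) 2+s≤f)))

-- The separating rational q has 2q + 1 in the upper cut of √N and 2q + 1 < 2f + 1; hence 2f + 1 is
-- in the upper cut too.
[√-1]/2<⇒< : ∀ {N f} → (√ N ⊕ - (+ 1)) ÷2 <ᴿ fromℤ (+ f) → N ℕ.< (f ℕ.+ f ℕ.+ 1) ℕ.* (f ℕ.+ f ℕ.+ 1)
[√-1]/2<⇒< {N} {f} (q , u , q<f) = ℕ.≰⇒> λ b²≤N → ℚ.<-irrefl refl (ℚ.<-≤-trans N<b² (/1-mono-≤ b²≤N))
  where
  b = f ℕ.+ f ℕ.+ 1
  2q+1<b : q ℚ.+ q ℚ.- (- (+ 1)) ℚ./ 1 ℚ.< + b ℚ./ 1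
  2q+1<b = subst (q ℚ.+ q ℚ.+ + 1 ℚ./ 1 ℚ.<_)
    (trans (cong (ℚ._+ + 1 ℚ./ 1) (/1-+ (+ f) (+ f))) (/1-+ (+ (f ℕ.+ f)) (+ 1)))
    (ℚ.+-monoˡ-< (+ 1 ℚ./ 1) (ℚ.+-mono-< q<f q<f))
  N<b² : + N ℚ./ 1 ℚ.< + (b ℕ.* b) ℚ./ 1
  N<b² = subst (+ N ℚ./ 1 ℚ.<_) (/1-* b b) (proj₂ (ℝ.U-upper (√ N) 2q+1<b u))

+-≤⇒≤-- : ∀ k {s f} → k ℕ.+ s ℕ.≤ f → + s ≤ - (+ k) + + f
+-≤⇒≤-- k {s} {f} k+s≤f = subst (_≤ - (+ k) + + f) (eq (+ k) (+ s)) (ℤ.+-monoʳ-≤ (- (+ k)) (ℤ.+≤+ k+s≤f))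
  where
  eq : ∀ k s → - k + (k + s) ≡ s
  eq = solve-∀

¬2∣⇒odd : ∀ n → ¬ (2 ℕ.∣ n) → ∃ λ j → n ≡ 1 ℕ.+ j ℕ.* 2
¬2∣⇒odd n 2∤n with n ℕ.divMod 2
... | ℕ.result j zero       eq = contradiction (ℕ.divides j eq) 2∤n
... | ℕ.result j (suc zero) eq = j , eq

theorem5p4 :
    (m v s : ℕ) → m ℕ.≥ 1 → v ≡ 4 ℕ.* m ℕ.∸ 1 →
    (G : Tournament v) → IsDoublyRegular G → TransitiveSubtournament G s →
    let n = 1 ℕ.+ 12 ℕ.* m
        ε = √ n ⊕ (- ⌊√ n ⌋)
        ε≡0 = ε ≃ᴿ fromℤ (+ 0)
    in
    (+ s ≤ - (+ 1) + ⌊√ n ⌋)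
    × (ε≡0 → fromℤ (+ s) ≤ᴿ √ n ⊕ - (+ 2))
    × (¬ ε≡0 → ¬ (+ 2 ∣ - (+ 1) + ⌊√ n ⌋) → + s ≤ - (+ 2) + ⌊√ n ⌋)
    × (¬ ε≡0 → (√ (1 ℕ.+ 48 ℕ.* m) ⊕ - (+ 1)) ÷2 <ᴿ fromℤ ⌊√ n ⌋ →
         + s ≤ - (+ 2) + ⌊√ n ⌋)
theorem5p4 m v s m≥1 v≡ G regular Γ =
  +-≤⇒≤-- 1 1+s≤f ,
  (λ (ε≤0 , _) → 2+≤isqrt⇒≤√-2 {n = n} (square (fractional-part≤0⇒square n ε≤0))) ,
  (λ _ 2∤f-1 → +-≤⇒≤-- 2 (2+s≤f λ f≡1+s → odd f≡1+s 2∤f-1)) ,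
  (λ _ √<f → +-≤⇒≤-- 2 (2+s≤f λ f≡1+s → large f≡1+s ([√-1]/2<⇒< {1 ℕ.+ 48 ℕ.* m} {f} √<f)))
  where
  n f : ℕ
  n = 1 ℕ.+ 12 ℕ.* m
  f = isqrt n

  [1+s][2+s]<n : suc s ℕ.* suc (suc s) ℕ.< n
  [1+s][2+s]<n = ℕ.s≤s (size-bound m≥1 v≡ G regular Γ)

  [1+s]²≤[1+s][2+s] : suc s ℕ.* suc s ℕ.≤ suc s ℕ.* suc (suc s)
  [1+s]²≤[1+s][2+s] = ℕ.*-monoʳ-≤ (suc s) (ℕ.n≤1+n (suc s))

  1+s≤f : suc s ℕ.≤ f
  1+s≤f = ≤isqrt {n = n} (ℕ.≤-trans [1+s]²≤[1+s][2+s] (ℕ.<⇒≤ [1+s][2+s]<n))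

  -- The sharper bounds gain one over the first, so each of them only has to exclude f = 1 + s.
  2+s≤f : f ≢ suc s → suc (suc s) ℕ.≤ f
  2+s≤f f≢1+s = ℕ.≤∧≢⇒< 1+s≤f (≢-sym f≢1+s)

  -- For f = 1 + s, n ≤ (1 + s)² would contradict (1 + s)(2 + s) < n.
  square : n ℕ.≤ f ℕ.* f → suc (suc s) ℕ.≤ f
  square n≤f² = 2+s≤f λ f≡1+s → ℕ.<⇒≱ [1+s][2+s]<n
    (ℕ.≤-trans n≤f² (subst (λ r → r ℕ.* r ℕ.≤ suc s ℕ.* suc (suc s)) (sym f≡1+s) [1+s]²≤[1+s][2+s]))

  -- Here f - 1 = s is odd, and the odd bound (s + 2)² ≤ n forces 2 + s ≤ f.
  odd : f ≡ suc s → ¬ ¬ (+ 2 ∣ - (+ 1) + + f)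
  odd f≡1+s 2∤f-1 with ¬2∣⇒odd s (subst (λ r → ¬ (+ 2 ∣ - (+ 1) + + r)) f≡1+s 2∤f-1)
  ... | j , s≡1+2j = ℕ.<-irrefl (sym f≡1+s) (≤isqrt {n = n} (odd-size-bound m≥1 v≡ G regular Γ j s≡1+2j))

  -- For f = 1 + s, (2f + 1)² = 1 + 4(1 + s)(2 + s), which is at most 1 + 48m by the size bound.
  large : f ≡ suc s → ¬ (1 ℕ.+ 48 ℕ.* m ℕ.< (f ℕ.+ f ℕ.+ 1) ℕ.* (f ℕ.+ f ℕ.+ 1))
  large f≡1+s rewrite f≡1+s = ℕ.≤⇒≯ (begin
    (suc s ℕ.+ suc s ℕ.+ 1) ℕ.* (suc s ℕ.+ suc s ℕ.+ 1) ≡⟨ eq s ⟩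
    1 ℕ.+ 4 ℕ.* (suc s ℕ.* suc (suc s))                 ≤⟨ ℕ.s≤s (ℕ.*-monoʳ-≤ 4 (ℕ.s≤s⁻¹ [1+s][2+s]<n)) ⟩
    1 ℕ.+ 4 ℕ.* (12 ℕ.* m)                              ≡⟨ cong suc (ℕ.*-assoc 4 12 m) ⟨
    1 ℕ.+ 48 ℕ.* m                                      ∎)
    where
    open ℕ.≤-Reasoning
    eq : ∀ s → (suc s ℕ.+ suc s ℕ.+ 1) ℕ.* (suc s ℕ.+ suc s ℕ.+ 1) ≡ 1 ℕ.+ 4 ℕ.* (suc s ℕ.* suc (suc s))
    eq = ℕ-Solver.solve-∀
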